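{- Let $n \geq 4$ be an integer and let $G$ be a (finite, simple) labelled graph with vertex set $V(G) = \{w_1, w_2, \ldots, w_n\}$. Suppose that $d(u) + d(v) \geq \frac{3n-1}{2}$ for each pair $u, v$ of non-adjacent vertices of $G$, where $d(\cdot)$ denotes degree in $G$. Then for every arboreal sequence $\sigma = d_1, d_2, \ldots, d_n$ with $1 \leq d_i \leq 3$ for $i = 1, 2, \ldots, n$, the graph $G$ contains a spanning tree $T$ with degree sequence $\sigma$.
   Context: An arboreal sequence is a sequence of positive integers $d_1, d_2, \ldots, d_n$ such that $\sum_{j=1}^{n} d_j = 2(n-1)$. For a labelled graph $G$ with vertex set $\{w_1,\ldots,w_n\}$ and an arboreal sequence $\sigma = d_1,\ldots,d_n$, a spanning tree $T$ of $G$ has degree sequence $\sigma$ if $d_T(w_i) = d_i$ for $i = 1, 2, \ldots, n$, where $d_T(w_i)$ is the degree of $w_i$ in $T$. -}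

module Defs where

open import Data.Nat using (ℕ; suc; _+_; _*_; _≤_; _∸_)
open import Data.Bool using (Bool; true; false; T)
open import Data.Fin using (Fin)
open import Data.List using (List; []; _∷_; length; filter; map)
open import Data.Nat.ListAction using (sum)
open import Data.List.Base using (allFin)
open import Data.List.Relation.Unary.Unique.Propositional using (Unique)
open import Data.Product using (Σ; _×_; _,_)
open import Relation.Binary.PropositionalEquality using (_≡_)
open import Relation.Nullary using (¬_)
open import Relation.Nullary.Decidable using (does)
open import Relation.Unary using (Decidable)

-- A finite simple labelled graph on vertex set Fin n (vertex i stands for w_{i+1}),
-- given by a Boolean adjacency function that is symmetric and irreflexive.
record Graph (n : ℕ) : Set where
  field
    adj   : Fin n → Fin n → Bool
    sym   : ∀ u v → adj u v ≡ adj v u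
    irrefl : ∀ u → adj u u ≡ false
open Graph public

Adjacent : ∀ {n} → Graph n → Fin n → Fin n → Set
Adjacent G u v = T (adj G u v)

degree : ∀ {n} → Graph n → Fin n → ℕ
degree {n} G u = length (Data.List.filter (λ v → Data.Bool._≟_ (adj G u v) true) (allFin n))

Subgraph : ∀ {n} → Graph n → Graph n → Set
Subgraph {n} H G = ∀ u v → Adjacent H u v → Adjacent G u v

data Walk {n} (H : Graph n) : Fin n → Fin n → Set where
  here : ∀ u → Walk H u u
  step : ∀ {u w v} → Adjacent H u w → Walk H w v → Walk H u v

Connected : ∀ {n} → Graph n → Set
Connected {n} H = ∀ u v → Walk H u v

PathList : ∀ {n} → Graph n → Fin n → List (Fin n) → Fin n → Set
PathList H x [] y = x ≡ y
PathList H x (z ∷ zs) y = Adjacent H x z × PathList H z zs y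

HasCycle : ∀ {n} → Graph n → Set
HasCycle {n} H =
  Σ (Fin n) λ x → Σ (List (Fin n)) λ vs → Σ (Fin n) λ y →
    (2 ≤ length vs) × Unique (x ∷ vs) × PathList H x vs y × Adjacent H y x

Acyclic : ∀ {n} → Graph n → Set
Acyclic H = ¬ HasCycle H

IsTree : ∀ {n} → Graph n → Set
IsTree H = Connected H × Acyclic H

SpanningTree : ∀ {n} → Graph n → Graph n → Set
SpanningTree T G = Subgraph T G × IsTree T

Arboreal : (n : ℕ) → (Fin n → ℕ) → Set
Arboreal n d = (∀ i → 1 ≤ d i) × sum (map d (allFin n)) ≡ 2 * (n ∸ 1)

HasDegreeSequence : ∀ {n} → Graph n → (Fin n → ℕ) → Set
HasDegreeSequence T d = ∀ i → degree T i ≡ d i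

{-# OPTIONS --safe #-}

-- Start from any tree on the vertices with the prescribed degrees, ignoring G, and suppose that it
-- uses an edge uv that is not in G. Deleting uv leaves a part rooted at u and a part rooted at v. If
-- y is a vertex of the part at u, with parent x, such that uy and vx are edges of G, then swapping
-- the subtree at y with the whole part at v keeps all degrees and replaces uv and xy by uy and
-- vx, which lowers the number of edges outside G. The same applies with u and v interchanged.
-- If no such y exists, each non-root vertex y of the part at u has at most one of uy, v(parent y) in G.
-- Summing over all y counts the neighbour x of v once for each child of x, hence misses only
-- leaves; as degrees are at most 3 there are at most (n + 2)/2 leaves, so d(u) + d(v) is at most
-- (n - 2) + (n + 2)/2 = (3n - 2)/2, contrary to the hypothesis on G.
module Submission where

open import Defs renaming (sym to adj-sym)
open import Data.Bool using (Bool; true; false; not; T; _∨_; _∧_)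
import Data.Bool as Bool
open import Data.Bool.Properties using (T-∨; T-∧; ∨-comm; ∧-comm)
open import Data.Empty using (⊥-elim)
open import Data.Fin using (Fin; zero; suc)
open import Data.Fin.Properties using (_≟_)
open import Data.List using (List; []; _∷_; length; filter; map; tabulate; allFin)
open import Data.List.Membership.DecPropositional using (_∈?_)
open import Data.List.Membership.Propositional using (_∈_; _∉_)
open import Data.List.Properties using (map-tabulate; length-tabulate)
open import Data.List.Relation.Unary.All using (All; []; _∷_)
import Data.List.Relation.Unary.All as All
open import Data.List.Relation.Unary.AllPairs using (_∷_)
open import Data.List.Relation.Unary.Any using (here; there)
open import Data.List.Relation.Unary.Unique.Propositional using (Unique)
open import Data.Nat using (ℕ; zero; suc; _+_; _*_; _∸_; _≤_; _<_; z≤n; s≤s; s≤s⁻¹)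
open import Data.Nat.ListAction using (sum)
open import Data.Nat.Properties hiding (_≟_)
open import Data.Nat.Properties using () renaming (_≟_ to _≟ℕ_)
open import Data.Nat.Tactic.RingSolver using (solve-∀)
open import Data.Product using (Σ; _×_; _,_; proj₁; proj₂)
open import Data.Sum using (_⊎_; inj₁; inj₂)
open import Data.Unit using (tt)
open import Function using (_∘_; id)
open import Function.Bundles using (module Equivalence)
open import Relation.Binary.PropositionalEquality
open import Relation.Nullary using (¬_; yes; no; does)

-- Indicators and sums over the vertices

ind : Bool → ℕ
ind true  = 1
ind false = 0

δ : ∀ {n} → Fin n → Fin n → ℕ
δ x y = ind (does (x ≟ y))

total : ∀ {n} → (Fin n → ℕ) → ℕ
total {n} f = sum (map f (allFin n))

module _ {A : Set} where

  sum-map-cong : {f g : A → ℕ} → (∀ x → f x ≡ g x) → ∀ xs → sum (map f xs) ≡ sum (map g xs)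
  sum-map-cong f≗g []       = refl
  sum-map-cong f≗g (x ∷ xs) = cong₂ _+_ (f≗g x) (sum-map-cong f≗g xs)

  sum-map-+ : (f g : A → ℕ) → ∀ xs →
    sum (map (λ x → f x + g x) xs) ≡ sum (map f xs) + sum (map g xs)
  sum-map-+ f g []       = refl
  sum-map-+ f g (x ∷ xs) rewrite sum-map-+ f g xs = lem (f x) (g x) _ _
    where
    lem : ∀ a b c e → a + b + (c + e) ≡ a + c + (b + e)
    lem = solve-∀

  sum-map-* : (c : ℕ) (f : A → ℕ) → ∀ xs → sum (map (λ x → c * f x) xs) ≡ c * sum (map f xs)
  sum-map-* c f []       = sym (*-zeroʳ c)
  sum-map-* c f (x ∷ xs) rewrite sum-map-* c f xs = sym (*-distribˡ-+ c (f x) _)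

  sum-map-1 : ∀ (xs : List A) → sum (map (λ _ → 1) xs) ≡ length xs
  sum-map-1 []       = refl
  sum-map-1 (x ∷ xs) = cong suc (sum-map-1 xs)

sum-tabulate-0 : ∀ {n} → sum (tabulate {n = n} (λ _ → 0)) ≡ 0
sum-tabulate-0 {zero}  = refl
sum-tabulate-0 {suc n} = sum-tabulate-0 {n}

sum-tabulate-δ : ∀ {n} (x : Fin n) (f : Fin n → ℕ) → sum (tabulate (λ y → δ x y * f y)) ≡ f x
sum-tabulate-δ {suc n} zero f =
  trans (cong₂ _+_ (+-identityʳ (f zero)) (sum-tabulate-0 {n})) (+-identityʳ (f zero))
sum-tabulate-δ (suc x) f = sum-tabulate-δ x (f ∘ suc)

total-δ* : ∀ {n} (x : Fin n) (f : Fin n → ℕ) → total (λ y → δ x y * f y) ≡ f x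
total-δ* x f = trans (cong sum (map-tabulate id (λ y → δ x y * f y))) (sum-tabulate-δ x f)

total-δ : ∀ {n} (x : Fin n) → total (δ x) ≡ 1
total-δ {n} x =
  trans (sum-map-cong (λ y → sym (*-identityʳ (δ x y))) (allFin n)) (total-δ* x (λ _ → 1))

δ-refl : ∀ {n} (x : Fin n) → δ x x ≡ 1
δ-refl x with x ≟ x
... | yes _  = refl
... | no x≢x = ⊥-elim (x≢x refl)

δ-sym : ∀ {n} (x y : Fin n) → δ x y ≡ δ y x
δ-sym x y with x ≟ y | y ≟ x
... | yes _ | yes _ = refl
... | no _  | no _  = refl
... | yes p | no q  = ⊥-elim (q (sym p))
... | no p  | yes q = ⊥-elim (p (sym q))

¬T-ind : ∀ {b} → ¬ T b → ind b ≡ 0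
¬T-ind {true}  ¬t = ⊥-elim (¬t tt)
¬T-ind {false} _  = refl

degree-total : ∀ {n} (G : Graph n) u → degree G u ≡ total (λ v → ind (adj G u v))
degree-total {n} G u = go (allFin n)
  where
  go : ∀ xs → length (filter (λ v → adj G u v Bool.≟ true) xs) ≡ sum (map (λ v → ind (adj G u v)) xs)
  go []       = refl
  go (x ∷ xs) with adj G u x
  ... | true  = cong suc (go xs)
  ... | false = go xs

-- Rooted forests and trees with prescribed degrees

-- A vertex with c children occurs in a forest only if its prescribed degree is suc c,
-- the extra edge being the one to its parent; k counts the roots of the forest.
data Forest {V : Set} (d : V → ℕ) : ℕ → Set where
  ∅    : Forest d 0
  node : ∀ {c k} (a : V) → d a ≡ suc c → Forest d c → Forest d k → Forest d (suc k)

module _ {V : Set} {d : V → ℕ} where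

  nsum : ∀ {k} → (V → ℕ) → Forest d k → ℕ
  nsum f ∅              = 0
  nsum f (node a _ C S) = f a + (nsum f C + nsum f S)

  -- The roots of the forest are regarded as children of p.
  esum : ∀ {k} → (V → V → ℕ) → V → Forest d k → ℕ
  esum w p ∅              = 0
  esum w p (node a _ C S) = w p a + (esum w a C + esum w p S)

  _++_ : ∀ {k l} → Forest d k → Forest d l → Forest d (k + l)
  ∅            ++ S = S
  node a e C A ++ S = node a e C (A ++ S)

  -- The order of siblings does not affect sums. Rerooting uses this to bring the current child in
  -- front of the siblings `A` that it has already searched.
  nsum-pull : ∀ {c k l} f a (e : d a ≡ suc c) (C : Forest d c)
    (A : Forest d k) (S : Forest d l) →
    nsum f (node a e C (A ++ S)) ≡ nsum f (A ++ node a e C S)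
  nsum-pull f a e C ∅              S = refl
  nsum-pull f a e C (node b _ B A) S rewrite sym (nsum-pull f a e C A S) =
    lem (f a) (nsum f C) (f b) (nsum f B) _
    where
    lem : ∀ a c b b′ s → a + (c + (b + (b′ + s))) ≡ b + (b′ + (a + (c + s)))
    lem = solve-∀

  esum-pull : ∀ {c k l} w p a (e : d a ≡ suc c) (C : Forest d c)
    (A : Forest d k) (S : Forest d l) →
    esum w p (node a e C (A ++ S)) ≡ esum w p (A ++ node a e C S)
  esum-pull w p a e C ∅              S = refl
  esum-pull w p a e C (node b _ B A) S rewrite sym (esum-pull w p a e C A S) =
    lem (w p a) (esum w a C) (w p b) (esum w b B) _
    where
    lem : ∀ a c b b′ s → a + (c + (b + (b′ + s))) ≡ b + (b′ + (a + (c + s)))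
    lem = solve-∀

  -- A weighted handshake count: a node contributes `g` once for each child and once for the edge to
  -- its parent, in all `d` times. The outer vertex `p` is counted once for each of the `k` roots.
  esum-degree : ∀ {k} (g : V → ℕ) p (F : Forest d k) →
    esum (λ x y → g x + g y) p F ≡ k * g p + nsum (λ x → d x * g x) F
  esum-degree g p ∅                        = refl
  esum-degree g p (node {c} {k} a e C S)
    rewrite esum-degree g a C | esum-degree g p S | e =
    lem (g p) (g a) c k (nsum (λ x → d x * g x) C) (nsum (λ x → d x * g x) S)
    where
    lem : ∀ p a c k C S → p + a + (c * a + C + (k * p + S)) ≡ p + k * p + (a + c * a + (C + S))
    lem = solve-∀

  split : ∀ c {k} → Forest d (c + k) → Forest d c × Forest d k
  split zero    F              = ∅ , F
  split (suc c) (node a e C S) = node a e C (proj₁ (split c S)) , proj₂ (split c S)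

  nsum-split : ∀ f c {k} (F : Forest d (c + k)) →
    nsum f F ≡ nsum f (proj₁ (split c F)) + nsum f (proj₂ (split c F))
  nsum-split f zero    F              = refl
  nsum-split f (suc c) (node a e C S) rewrite nsum-split f c S = lem (f a) (nsum f C) _ _
    where
    lem : ∀ x c a s → x + (c + (a + s)) ≡ x + (c + a) + s
    lem = solve-∀

-- The root has no parent, so all of its degree goes to children, without the `suc` of a forest
-- node.
record Tree {V : Set} (d : V → ℕ) : Set where
  constructor tree
  field
    root    : V
    {arity} : ℕ
    arity≡  : d root ≡ arity
    kids    : Forest d arity

open Tree

module _ {V : Set} {d : V → ℕ} where

  nodes : (V → ℕ) → Tree d → ℕ
  nodes f t = f (root t) + nsum f (kids t)

  edges : (V → V → ℕ) → Tree d → ℕ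
  edges w t = esum w (root t) (kids t)

-- Each vertex occurs exactly once: take `f` to be an indicator. In this form, degree sums,
-- neighbour counts and the number of vertices are instances, and rearranging a tree is plain
-- arithmetic.
Spans : ∀ {n} {d : Fin n → ℕ} → Tree d → Set
Spans t = ∀ f → nodes f t ≡ total f

-- Rerooting at a given edge

module _ {V : Set} {d : V → ℕ} where

  -- The edge `uv` of nonzero weight is brought to the top, so that deleting it leaves `u` with `Fu`
  -- and `v` with `Fv`. That the unrooted tree is unchanged is expressed through its node and edge
  -- sums.
  record Rerooted (w : V → V → ℕ) (t : Tree d) : Set where
    constructor rerooted
    field
      {cu cv} : ℕ
      u v     : V
      eu      : d u ≡ suc cu
      ev      : d v ≡ suc cv
      Fu      : Forest d cu
      Fv      : Forest d cv
      w≢0     : w u v ≢ 0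
      nodes≡  : ∀ f → nodes f (tree u eu (node v ev Fv Fu)) ≡ nodes f t
      edges≡  : edges w (tree u eu (node v ev Fv Fu)) ≡ edges w t

  -- The forest A collects the part of the tree already searched, hanging from the current vertex p.
  reroot : (w : V → V → ℕ) → (∀ x y → w x y ≡ w y x) →
    ∀ {m k} p (e : d p ≡ m + k) (A : Forest d m) (F : Forest d k) →
    esum w p F ≡ 0 ⊎ Rerooted w (tree p e (A ++ F))
  reroot w w-sym p e A ∅ = inj₁ refl
  reroot w w-sym {m} {suc k} p e A (node a ea C S) = go (w p a ≟ℕ 0)
    where
    e′ : d p ≡ suc (m + k)
    e′ = trans e (+-suc m k)
    nodes-pull : ∀ f → f p + nsum f (node a ea C (A ++ S)) ≡ f p + nsum f (A ++ node a ea C S)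
    nodes-pull f = cong (f p +_) (nsum-pull f a ea C A S)
    edges-pull : esum w p (node a ea C (A ++ S)) ≡ esum w p (A ++ node a ea C S)
    edges-pull = esum-pull w p a ea C A S
    nodes-turn : ∀ a p n c → a + (p + (n + c)) ≡ p + (a + (c + n))
    nodes-turn = solve-∀
    go : _ → _
    go (no wpa≢0) = inj₂ (rerooted p a e′ ea (A ++ S) C wpa≢0 nodes-pull edges-pull)
    -- Either `a` becomes the root and the rest of the tree, rooted at `p`, becomes its child, which
    -- reverses the edge `pa`; or `a` joins the searched siblings and the search goes on below `p`.
    go (yes wpa≡0)
      with reroot w w-sym a ea (node p e′ (A ++ S) ∅) C | reroot w w-sym p e′ (node a ea C A) S
    ... | inj₁ C≡0 | inj₁ S≡0 = inj₁ (cong₂ _+_ wpa≡0 (cong₂ _+_ C≡0 S≡0))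
    ... | inj₂ r   | _        = inj₂ record { Rerooted r
          ; nodes≡ = λ f → trans (Rerooted.nodes≡ r f)
              (trans (nodes-turn (f a) (f p) _ (nsum f C)) (nodes-pull f))
          ; edges≡ = trans (Rerooted.edges≡ r)
              (trans (cong₂ _+_ (w-sym a p) (+-comm _ (esum w a C))) edges-pull) }
    ... | inj₁ _   | inj₂ r   = inj₂ record { Rerooted r
          ; nodes≡ = λ f → trans (Rerooted.nodes≡ r f) (nodes-pull f)
          ; edges≡ = trans (Rerooted.edges≡ r) edges-pull }

-- Realising an arboreal sequence by a tree

module _ {n : ℕ} {d : Fin n → ℕ} where

  2*length≤sum : ∀ {ys} → All (λ y → 2 ≤ d y) ys → 2 * length ys ≤ sum (map d ys)
  2*length≤sum []                       = z≤n
  2*length≤sum {_ ∷ ys} (2≤dy ∷ 2≤d) rewrite *-suc 2 (length ys) = +-mono-≤ 2≤dy (2*length≤sum 2≤d)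

  -- Postfix evaluation: the forest is a stack, from which a vertex with c children pops c trees.
  attach : ∀ {ys} → All (λ y → 2 ≤ d y) ys → ∀ {k} (F : Forest d k) →
    k + 2 * length ys ≡ 2 + sum (map d ys) →
    Σ (Forest d 2) λ F′ → ∀ f → nsum f F′ ≡ nsum f F + sum (map f ys)
  attach [] {k} F eq rewrite trans (sym (+-identityʳ k)) eq =
    F , λ f → sym (+-identityʳ (nsum f F))
  attach {y ∷ ys} (2≤dy ∷ 2≤d) {k} F eq with d y in ey
  ... | suc c with m≤n⇒∃[o]m+o≡n c≤k
    where
    -- The stack is deep enough to pop `c` trees: the vertices still waiting have degree at least 2,
    -- so the balance `eq` even forces `k` to exceed `c`.
    c≤k : c ≤ k
    c≤k = +-cancelʳ-≤ (2 * suc (length ys)) c k (begin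
      c + 2 * suc (length ys)       ≡⟨ e c (length ys) ⟩
      2 + (c + 2 * length ys)       ≤⟨ +-monoʳ-≤ 2 (+-mono-≤ (n≤1+n c) (2*length≤sum 2≤d)) ⟩
      2 + (suc c + sum (map d ys))  ≡⟨ eq ⟨
      k + 2 * suc (length ys)       ∎)
      where
      open ≤-Reasoning
      e : ∀ c l → c + 2 * suc l ≡ 2 + (c + 2 * l)
      e = solve-∀
  ... | k′ , refl = proj₁ rest , λ f → trans (proj₂ rest f)
        (trans (e₂ (f y) (nsum f (proj₁ (split c F))) (nsum f (proj₂ (split c F))) (sum (map f ys)))
          (cong (_+ (f y + sum (map f ys))) (sym (nsum-split f c F))))
    where
    e₁ : ∀ c k l → suc c + (suc k + 2 * l) ≡ c + k + 2 * suc l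
    e₁ = solve-∀
    e₂ : ∀ x a b z → x + (a + b) + z ≡ a + b + (x + z)
    e₂ = solve-∀
    e₃ : ∀ c s → 2 + (suc c + s) ≡ suc c + (2 + s)
    e₃ = solve-∀
    rest = attach 2≤d (node y ey (proj₁ (split c F)) (proj₂ (split c F)))
      (+-cancelˡ-≡ (suc c) _ _ (trans (e₁ c k′ (length ys)) (trans eq (e₃ c (sum (map d ys))))))

  module _ (1≤d : ∀ i → 1 ≤ d i) where

    -- Leaves are pushed at once and all other vertices deferred to `ys`, so that the stack never
    -- runs short in `attach`. The equation is the degree balance of a process that ends with two
    -- trees.
    leaves-first : ∀ xs {ys} → All (λ y → 2 ≤ d y) ys → ∀ {k} (F : Forest d k) →
      k + 2 * length ys + 2 * length xs ≡ 2 + sum (map d ys) + sum (map d xs) →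
      Σ (Forest d 2) λ F′ → ∀ f → nsum f F′ ≡ nsum f F + sum (map f ys) + sum (map f xs)
    leaves-first [] 2≤d F eq
      with attach 2≤d F (trans (sym (+-identityʳ _)) (trans eq (+-identityʳ _)))
    ... | F′ , F′≡ = F′ , λ f → trans (F′≡ f) (sym (+-identityʳ _))
    leaves-first (x ∷ xs) {ys} 2≤d {k} F eq with d x in ex | 1≤d x
    ... | 1 | _ = proj₁ rest , λ f → trans (proj₂ rest f) (e₂ (f x) (nsum f F) _ _)
      where
      e₁ : ∀ k l m → suc (suc k + l + 2 * m) ≡ k + l + 2 * suc m
      e₁ = solve-∀
      e₂ : ∀ x F y z → x + F + y + z ≡ F + y + (x + z)
      e₂ = solve-∀
      rest = leaves-first xs 2≤d (node x ex ∅ F)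
        (suc-injective (trans (e₁ k (2 * length ys) (length xs)) (trans eq (+-suc (2 + sum (map d ys)) _))))
    ... | suc (suc c) | _ = proj₁ rest , λ f → trans (proj₂ rest f) (e₂ (f x) (nsum f F) _ _)
      where
      2≤dx : 2 ≤ d x
      2≤dx = subst (2 ≤_) (sym ex) (s≤s (s≤s z≤n))
      e₁ : ∀ k l m → k + 2 * suc l + 2 * m ≡ k + 2 * l + 2 * suc m
      e₁ = solve-∀
      e₂ : ∀ x F y z → F + (x + y) + z ≡ F + y + (x + z)
      e₂ = solve-∀
      e₃ : ∀ x y z → 2 + y + (x + z) ≡ 2 + (x + y) + z
      e₃ = solve-∀
      rest = leaves-first xs (2≤dx ∷ 2≤d) F
        (trans (e₁ k (length ys) (length xs)) (trans eq
          (trans (e₃ (suc (suc c)) (sum (map d ys)) _)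
            (cong (λ z → 2 + (z + sum (map d ys)) + sum (map d xs)) (sym ex)))))

    realise : 1 ≤ n → total d ≡ 2 * (n ∸ 1) → Σ (Tree d) Spans
    realise 1≤n Σd with leaves-first (allFin n) [] ∅ (begin
        2 * length (allFin n)  ≡⟨ cong (2 *_) (length-tabulate {n = n} id) ⟩
        2 * n                  ≡⟨ cong (2 *_) (m+[n∸m]≡n 1≤n) ⟨
        2 * suc (n ∸ 1)        ≡⟨ *-suc 2 (n ∸ 1) ⟩
        2 + 2 * (n ∸ 1)        ≡⟨ cong (2 +_) Σd ⟨
        2 + total d            ∎)
      where open ≡-Reasoning
    ... | node a ea C (node b eb D ∅) , F≡ =
      -- Both roots still lack one edge; joining them makes `b` a child of `a` and completes both
      -- degrees.
      tree a ea (node b eb D C) , λ f → trans (e (f a) (f b) (nsum f C) (nsum f D)) (F≡ f)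
      where
      e : ∀ a b c d → a + (b + (d + c)) ≡ a + (c + (b + (d + 0)))
      e = solve-∀

-- Edges outside G and the search for a swap

module _ {n : ℕ} (G : Graph n) where

  nbr : Fin n → Fin n → ℕ
  nbr u x = ind (adj G u x)

  -- As an edge weight it makes `edges (bad G) t` the number of tree edges outside `G`, the quantity
  -- that descends.
  bad : Fin n → Fin n → ℕ
  bad u x = ind (not (adj G u x))

  bad-sym : ∀ u x → bad u x ≡ bad x u
  bad-sym u x = cong (ind ∘ not) (adj-sym G u x)

  bad-adjacent : ∀ {u x} → Adjacent G u x → bad u x ≡ 0
  bad-adjacent {u} {x} ux with adj G u x
  ... | true = refl

  adjacent-bad : ∀ {u x} → bad u x ≡ 0 → Adjacent G u x
  adjacent-bad {u} {x} ux with adj G u x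
  ... | true = tt

  bad≢0 : ∀ {u x} → bad u x ≢ 0 → ¬ Adjacent G u x
  bad≢0 b ux = b (bad-adjacent ux)

module _ {n : ℕ} (G : Graph n) {d : Fin n → ℕ} where

  -- The subtree at some vertex a with parent x is replaced by the tree at v.
  record Swap (u v : Fin n) {cv} (Fv : Forest d cv) (p : Fin n) {k} (F : Forest d k) : Set where
    field
      {c}   : ℕ
      x a   : Fin n
      ea    : d a ≡ suc c
      C     : Forest d c
      F′    : Forest d k
      ua    : Adjacent G u a
      vx    : Adjacent G v x
      nsum≡ : ∀ f → f a + nsum f C + nsum f F′ ≡ f v + nsum f Fv + nsum f F
      esum≡ : ∀ w → w x a + esum w a C + esum w p F′ ≡ w x v + esum w v Fv + esum w p F

  module _ (d≤3 : ∀ i → d i ≤ 3) (u v : Fin n) {cv} (ev : d v ≡ suc cv) (Fv : Forest d cv) where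

    private
      -- The doubled count of neighbours, with 3 - d bounding twice the number of leaves pointwise:
      -- unlike the number of leaves, the sum of d over the tree is known.
      Bound : Fin n → ∀ {k} → Forest d k → Set
      Bound p {k} F =
        2 * nsum (nbr G u) F + 2 * (k * nbr G v p) + 2 * nsum (nbr G v) F + nsum d F ≤ 5 * nsum (λ _ → 1) F

      -- A neighbour of `v` with `c` children is counted `c` times through them but is wanted once.
      -- Only a leaf falls short, and its slack of 3 minus its degree 1 pays for the doubled count.
      local : ∀ c b → c ≤ 2 → 2 * ind b + suc c ≤ 3 + 2 * (c * ind b)
      local 0 true  _ = ≤-refl
      local 0 false _ = s≤s z≤n
      local 1 true  _ = s≤s (s≤s (s≤s (s≤s z≤n)))
      local 1 false _ = s≤s (s≤s z≤n)
      local 2 true  _ = s≤s (s≤s (s≤s (s≤s (s≤s z≤n))))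
      local 2 false _ = ≤-refl
      local (suc (suc (suc _))) _ (s≤s (s≤s ()))

      -- Here `α` and `β` stand for the edges `ua` and `vp` of `G`, and `α + β ≤ 1` says that no
      -- swap is possible at `a`.
      bound : ∀ {c k a} (ea : d a ≡ suc c) (C : Forest d c) (S : Forest d k) α β →
        2 * nsum (nbr G u) C + 2 * (c * nbr G v a) + 2 * nsum (nbr G v) C + nsum d C ≤ 5 * nsum (λ _ → 1) C →
        2 * nsum (nbr G u) S + 2 * (k * β) + 2 * nsum (nbr G v) S + nsum d S ≤ 5 * nsum (λ _ → 1) S →
        α + β ≤ 1 →
        2 * (α + (nsum (nbr G u) C + nsum (nbr G u) S)) + 2 * (suc k * β)
          + 2 * (nbr G v a + (nsum (nbr G v) C + nsum (nbr G v) S)) + (d a + (nsum d C + nsum d S))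
          ≤ 5 * (1 + (nsum (λ _ → 1) C + nsum (λ _ → 1) S))
      bound {c} {k} {a} ea C S α β C≤ S≤ α+β≤1 rewrite ea =
        -- The bound for `C` counts `a` once per child. Adding that term to both sides lets `local`
        -- trade it for a single count of `a`.
        +-cancelˡ-≤ (2 * (c * nbr G v a)) _ _ (begin
          _ ≡⟨ left α β c k (nbr G v a) (nsum (nbr G u) C) (nsum (nbr G u) S) (nsum (nbr G v) C)
                 (nsum (nbr G v) S) (nsum d C) (nsum d S) ⟩
          _ ≤⟨ +-mono-≤ (*-monoʳ-≤ 2 α+β≤1)
                 (+-mono-≤ (local c (adj G v a) (s≤s⁻¹ (subst (_≤ 3) ea (d≤3 a)))) (+-mono-≤ C≤ S≤)) ⟩
          _ ≡⟨ right (2 * (c * nbr G v a)) (nsum (λ _ → 1) C) (nsum (λ _ → 1) S) ⟩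
          _ ∎)
        where
        open ≤-Reasoning
        left : ∀ α β c k b uC uS vC vS dC dS →
          2 * (c * b) + (2 * (α + (uC + uS)) + 2 * (suc k * β) + 2 * (b + (vC + vS)) + (suc c + (dC + dS)))
          ≡ 2 * (α + β) + (2 * b + suc c +
            (2 * uC + 2 * (c * b) + 2 * vC + dC + (2 * uS + 2 * (k * β) + 2 * vS + dS)))
        left = solve-∀
        right : ∀ x C S → 2 + (3 + x + (5 * C + 5 * S)) ≡ x + 5 * (1 + (C + S))
        right = solve-∀

    -- The second alternative is reached only if each vertex `a` of `F`, with parent `x`, lacks one
    -- of the edges `ua` and `vx`; `bound` adds up these failures along the recursion.
    swap? : ∀ p {k} (F : Forest d k) → Swap u v Fv p F ⊎ Bound p F
    swap? p ∅ = inj₂ ≤-refl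
    swap? p (node {c} {k} a ea C S)
      with adj G u a in ua | adj G v p in vp | swap? a C | swap? p S
    ... | true | true | _ | _ = inj₁ record
      { x = p ; a = a ; ea = ea ; C = C ; F′ = node v ev Fv S
      ; ua = subst T (sym ua) tt ; vx = subst T (sym vp) tt
      ; nsum≡ = λ f → shuffle (f a) (nsum f C) (f v) (nsum f Fv) (nsum f S)
      ; esum≡ = λ w → shuffle (w p a) (esum w a C) (w p v) (esum w v Fv) (esum w p S) }
      where
      shuffle : ∀ a c v f s → a + c + (v + (f + s)) ≡ v + f + (a + (c + s))
      shuffle = solve-∀
    ... | _ | _ | inj₁ s | _ = inj₁ record { Swap s
      ; F′ = node a ea F′ S
      ; nsum≡ = λ f → lift (f a) (f b + nsum f B) (f v + nsum f Fv) (nsum f S) (nsum≡ f)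
      ; esum≡ = λ w → lift (w p a) (w y b + esum w b B) (w y v + esum w v Fv) (esum w p S) (esum≡ w) }
      where
      open Swap s using (F′; nsum≡; esum≡) renaming (x to y; a to b; C to B)
      lift : ∀ x y z s {m l} → y + m ≡ z + l → y + (x + (m + s)) ≡ z + (x + (l + s))
      lift x y z s {m} {l} eq =
        trans (out x y m s) (trans (cong (λ t → x + (t + s)) eq) (sym (out x z l s)))
        where
        out : ∀ x y m s → y + (x + (m + s)) ≡ x + (y + m + s)
        out = solve-∀
    ... | _ | _ | inj₂ _ | inj₁ s = inj₁ record { Swap s
      ; F′ = node a ea C F′
      ; nsum≡ = λ f → lift (f a) (f b + nsum f B) (f v + nsum f Fv) (nsum f C) (nsum≡ f)
      ; esum≡ = λ w → lift (w p a) (w y b + esum w b B) (w y v + esum w v Fv) (esum w a C) (esum≡ w) }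
      where
      open Swap s using (F′; nsum≡; esum≡) renaming (x to y; a to b; C to B)
      lift : ∀ x y z s {m l} → y + m ≡ z + l → y + (x + (s + m)) ≡ z + (x + (s + l))
      lift x y z s {m} {l} eq =
        trans (out x y m s) (trans (cong (λ t → x + (s + t)) eq) (sym (out x z l s)))
        where
        out : ∀ x y m s → y + (x + (s + m)) ≡ x + (s + (y + m))
        out = solve-∀
    ... | true  | false | inj₂ C≤ | inj₂ S≤ = inj₂ (bound ea C S 1 0 C≤ S≤ ≤-refl)
    ... | false | true  | inj₂ C≤ | inj₂ S≤ = inj₂ (bound ea C S 0 1 C≤ S≤ ≤-refl)
    ... | false | false | inj₂ C≤ | inj₂ S≤ = inj₂ (bound ea C S 0 0 C≤ S≤ z≤n)

-- Reducing the number of edges outside G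

-- In the use below, `m` counts the vertices other than `u` and `v`, `D` is their prescribed degree
-- sum, and `x` is the degree sum of `u` and `v` in `G`. As `D` is at least 2(n - 1) - 6, the bound
-- gives 2x at most 3n - 2, while the hypothesis on `G` asks for at least 3n - 1.
counting : ∀ {n m D x a b} → n ≡ suc (suc m) → a + (b + D) ≡ 2 * (n ∸ 1) → a ≤ 3 → b ≤ 3 →
  2 * x + D ≤ 5 * m → ¬ (3 * n ≤ 2 * x + 1)
counting {m = m} {D} {x} {a} {b} refl total-d a≤3 b≤3 few many = <-irrefl refl (begin-strict
  5 * m + 7                        <⟨ n<1+n (5 * m + 7) ⟩
  suc (5 * m + 7)                  ≡⟨ e₁ m ⟩
  3 * suc (suc m) + 2 * suc m      ≡⟨ cong (3 * suc (suc m) +_) total-d ⟨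
  3 * suc (suc m) + (a + (b + D))  ≤⟨ +-mono-≤ many (+-mono-≤ a≤3 (+-monoˡ-≤ D b≤3)) ⟩
  2 * x + 1 + (3 + (3 + D))        ≡⟨ e₂ x D ⟩
  2 * x + D + 7                    ≤⟨ +-monoˡ-≤ 7 few ⟩
  5 * m + 7                        ∎)
  where
  open ≤-Reasoning
  e₁ : ∀ m → suc (5 * m + 7) ≡ 3 * suc (suc m) + 2 * suc m
  e₁ = solve-∀
  e₂ : ∀ x D → 2 * x + 1 + (3 + (3 + D)) ≡ 2 * x + D + 7
  e₂ = solve-∀

module _ {n : ℕ} (G : Graph n) {d : Fin n → ℕ} where

  Better : Tree d → Set
  Better t = Σ (Tree d) λ t′ → (∀ f → nodes f t′ ≡ nodes f t) × edges (bad G) t′ < edges (bad G) t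

  exchange : ∀ {u v cu cv} (eu : d u ≡ suc cu) (ev : d v ≡ suc cv)
    (Fu : Forest d cu) (Fv : Forest d cv) → bad G u v ≢ 0 →
    Swap G u v Fv u Fu → Better (tree u eu (node v ev Fv Fu))
  exchange {u} {v} eu ev Fu Fv uv≢0 s = tree u eu (node a ea C F′) , nodes-same , edges-fewer
    where
    open Swap s
    w : Fin n → Fin n → ℕ
    w = bad G
    nodes-same : ∀ f → _
    nodes-same f = cong (f u +_)
      (trans (sym (+-assoc (f a) _ _)) (trans (nsum≡ f) (+-assoc (f v) _ _)))
    edges-fewer : w u a + (esum w a C + esum w u F′) < w u v + (esum w v Fv + esum w u Fu)
    edges-fewer = begin-strict
      w u a + (esum w a C + esum w u F′)  ≡⟨ cong (_+ (esum w a C + esum w u F′)) (bad-adjacent G ua) ⟩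
      -- The removed edge `xa` may or may not lie in `G`; the strict decrease comes from `uv` alone.
      esum w a C + esum w u F′            ≤⟨ m≤n+m _ (w x a) ⟩
      w x a + (esum w a C + esum w u F′)  ≡⟨ +-assoc (w x a) _ _ ⟨
      w x a + esum w a C + esum w u F′    ≡⟨ esum≡ w ⟩
      w x v + esum w v Fv + esum w u Fu
        ≡⟨ cong (λ z → z + esum w v Fv + esum w u Fu) (trans (bad-sym G x v) (bad-adjacent G vx)) ⟩
      esum w v Fv + esum w u Fu           <⟨ m<n+m _ (n≢0⇒n>0 uv≢0) ⟩
      w u v + (esum w v Fv + esum w u Fu) ∎
      where open ≤-Reasoning

  module _
    (ore : ∀ u v → u ≢ v → ¬ Adjacent G u v → 3 * n ≤ 2 * (degree G u + degree G v) + 1)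
    (Σd : total d ≡ 2 * (n ∸ 1)) (d≤3 : ∀ i → d i ≤ 3) where

    -- A swap is sought on both sides of `uv`. If both searches fail, their two bounds together
    -- cover every vertex except `u` and `v`, and `counting` applies.
    improve-at : ∀ {u v cu cv} (eu : d u ≡ suc cu) (ev : d v ≡ suc cv)
      (Fu : Forest d cu) (Fv : Forest d cv) → bad G u v ≢ 0 →
      Spans (tree u eu (node v ev Fv Fu)) → Better (tree u eu (node v ev Fv Fu))
    improve-at {u} {v} {cu} {cv} eu ev Fu Fv uv≢0 spans
      with swap? G d≤3 u v ev Fv u Fu | swap? G d≤3 v u eu Fu v Fv
    ... | inj₁ s | _ = exchange eu ev Fu Fv uv≢0 s
    -- The swap was found with `v` as root; exchanging the two ends of `uv` leaves all sums
    -- unchanged.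
    ... | inj₂ _ | inj₁ s = t′ , (λ f → trans (nodes-same f) (x∙yz f)) , subst (edges (bad G) t′ <_) flip edges-fewer
      where
      better : Better (tree v ev (node u eu Fu Fv))
      better = exchange ev eu Fv Fu (λ vu≡0 → uv≢0 (trans (bad-sym G u v) vu≡0)) s
      t′ = proj₁ better
      nodes-same = proj₁ (proj₂ better)
      edges-fewer = proj₂ (proj₂ better)
      x∙yz : ∀ f → f v + (f u + (nsum f Fu + nsum f Fv)) ≡ f u + (f v + (nsum f Fv + nsum f Fu))
      x∙yz f = e (f v) (f u) (nsum f Fu) (nsum f Fv)
        where
        e : ∀ v u x y → v + (u + (x + y)) ≡ u + (v + (y + x))
        e = solve-∀
      flip = cong₂ _+_ (bad-sym G v u) (+-comm (esum (bad G) u Fu) (esum (bad G) v Fv))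
    ... | inj₂ Fu≤ | inj₂ Fv≤ = ⊥-elim
      (counting {x = degree G u + degree G v} n≡ (trans (spans d) Σd) (d≤3 u) (d≤3 v) few (ore u v u≢v uv))
      where
      uv : ¬ Adjacent G u v
      uv = bad≢0 G uv≢0
      vu : ¬ Adjacent G v u
      vu a = uv (subst T (adj-sym G v u) a)
      u≢v : u ≢ v
      -- If `u` and `v` coincided, the spanning tree would list this vertex twice.
      u≢v refl = twice (δ-refl u) (trans (spans (δ u)) (total-δ u))
        where
        twice : ∀ {a r} → a ≡ 1 → a + (a + r) ≢ 1
        twice refl ()
      n≡ : n ≡ suc (suc (nsum (λ _ → 1) Fv + nsum (λ _ → 1) Fu))
      n≡ = trans (sym (trans (sum-map-1 (allFin n)) (length-tabulate id))) (sym (spans (λ _ → 1)))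
      degree-u : degree G u ≡ nsum (nbr G u) Fv + nsum (nbr G u) Fu
      degree-u = trans (degree-total G u) (trans (sym (spans (nbr G u)))
        (cong₂ (λ x y → x + (y + (nsum (nbr G u) Fv + nsum (nbr G u) Fu))) (cong ind (irrefl G u)) (¬T-ind uv)))
      degree-v : degree G v ≡ nsum (nbr G v) Fv + nsum (nbr G v) Fu
      degree-v = trans (degree-total G v) (trans (sym (spans (nbr G v)))
        (cong₂ (λ x y → x + (y + (nsum (nbr G v) Fv + nsum (nbr G v) Fu))) (¬T-ind vu) (cong ind (irrefl G v))))
      few : 2 * (degree G u + degree G v) + (nsum d Fv + nsum d Fu)
        ≤ 5 * (nsum (λ _ → 1) Fv + nsum (λ _ → 1) Fu)
      few rewrite degree-u | degree-v = begin
        2 * (uFv + uFu + (vFv + vFu)) + (nsum d Fv + nsum d Fu)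
          -- The two bounds also carry the terms `kv` and `ku`, in which `u` and `v` are the parents
          -- of the forest roots.
          ≤⟨ m≤m+n _ (2 * kv + 2 * ku) ⟩
        2 * (uFv + uFu + (vFv + vFu)) + (nsum d Fv + nsum d Fu) + (2 * kv + 2 * ku)
          ≡⟨ e uFv uFu vFv vFu (nsum d Fv) (nsum d Fu) kv ku ⟩
        2 * vFv + 2 * kv + 2 * uFv + nsum d Fv + (2 * uFu + 2 * ku + 2 * vFu + nsum d Fu)
          ≤⟨ +-mono-≤ Fv≤ Fu≤ ⟩
        5 * nsum (λ _ → 1) Fv + 5 * nsum (λ _ → 1) Fu
          ≡⟨ *-distribˡ-+ 5 (nsum (λ _ → 1) Fv) _ ⟨
        5 * (nsum (λ _ → 1) Fv + nsum (λ _ → 1) Fu) ∎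
        where
        open ≤-Reasoning
        uFv = nsum (nbr G u) Fv
        uFu = nsum (nbr G u) Fu
        vFv = nsum (nbr G v) Fv
        vFu = nsum (nbr G v) Fu
        kv = cv * nbr G u v
        ku = cu * nbr G v u
        e : ∀ uFv uFu vFv vFu dv du kv ku →
          2 * (uFv + uFu + (vFv + vFu)) + (dv + du) + (2 * kv + 2 * ku)
          ≡ 2 * vFv + 2 * kv + 2 * uFv + dv + (2 * uFu + 2 * ku + 2 * vFu + du)
        e = solve-∀

    improve : ∀ t → Spans t → edges (bad G) t ≡ 0 ⊎ Better t
    improve (tree p e F) spans with reroot (bad G) (bad-sym G) p e ∅ F
    ... | inj₁ good = inj₁ good
    ... | inj₂ (rerooted u v eu ev Fu Fv uv≢0 nodes≡ edges≡)
      with improve-at eu ev Fu Fv uv≢0 (λ f → trans (nodes≡ f) (spans f))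
    ... | t′ , nodes-same , fewer =
      inj₂ (t′ , (λ f → trans (nodes-same f) (nodes≡ f)) , subst (edges (bad G) t′ <_) edges≡ fewer)

    -- Recursion on `b`, an upper bound for the number of edges outside `G`, which every improvement
    -- lowers.
    perfect : ∀ b t → Spans t → edges (bad G) t ≤ b →
      Σ (Tree d) λ t′ → Spans t′ × edges (bad G) t′ ≡ 0
    perfect b t spans t≤b with improve t spans
    ... | inj₁ good = t , spans , good
    perfect zero    t spans t≤b | inj₂ (t′ , nodes-same , fewer) =
      ⊥-elim (n≮0 (<-≤-trans fewer t≤b))
    perfect (suc b) t spans t≤b | inj₂ (t′ , nodes-same , fewer) =
      perfect b t′ (λ f → trans (nodes-same f) (spans f)) (s≤s⁻¹ (≤-trans fewer t≤b))

-- Attaching a leaf to a graph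

ind-∧ : ∀ x y → ind (x ∧ y) ≡ ind x * ind y
ind-∧ true  y = sym (+-identityʳ (ind y))
ind-∧ false y = refl

ind-∨ : ∀ x y → ¬ (T x × T y) → ind (x ∨ y) ≡ ind x + ind y
ind-∨ true  true  disjoint = ⊥-elim (disjoint (tt , tt))
ind-∨ true  false _        = refl
ind-∨ false y     _        = refl

T-does : ∀ {n} {x y : Fin n} → T (does (x ≟ y)) → x ≡ y
T-does {x = x} {y} t with x ≟ y
... | yes x≡y = x≡y

does-T : ∀ {n} (x : Fin n) → T (does (x ≟ x))
does-T x with x ≟ x
... | yes _  = tt
... | no x≢x = x≢x refl

walk-map : ∀ {n} {H K : Graph n} → Subgraph H K → ∀ {u v} → Walk H u v → Walk K u v
walk-map H⊆K (here u)   = here u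
walk-map H⊆K (step e w) = step (H⊆K _ _ e) (walk-map H⊆K w)

walk-snoc : ∀ {n} {H : Graph n} {u v w} → Walk H u v → Adjacent H v w → Walk H u w
walk-snoc (here u)   f = step f (here _)
walk-snoc (step e w) f = step e (walk-snoc w f)

path-end : ∀ {n} (H : Graph n) {x} z zs {y} → PathList H x (z ∷ zs) y → y ∈ z ∷ zs
path-end H z []       (_ , refl) = here refl
path-end H z (w ∷ ws) (_ , path) = there (path-end H w ws path)

module AddLeaf {n : ℕ} (H : Graph n) (p a : Fin n) (p≢a : p ≢ a)
  (isolated : ∀ j → ¬ Adjacent H a j) where

  joins : Fin n → Fin n → Bool
  joins i j = (does (p ≟ i) ∧ does (a ≟ j)) ∨ (does (a ≟ i) ∧ does (p ≟ j))

  joins⁻¹ : ∀ {i j} → T (joins i j) → (p ≡ i × a ≡ j) ⊎ (a ≡ i × p ≡ j)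
  joins⁻¹ {i} {j} t with Equivalence.to (T-∨ {does (p ≟ i) ∧ does (a ≟ j)}) t
  ... | inj₁ s with Equivalence.to (T-∧ {does (p ≟ i)}) s
  ...   | s₁ , s₂ = inj₁ (T-does s₁ , T-does s₂)
  joins⁻¹ {i} {j} t | inj₂ s with Equivalence.to (T-∧ {does (a ≟ i)}) s
  ...   | s₁ , s₂ = inj₂ (T-does s₁ , T-does s₂)

  joins-irrefl : ∀ i → joins i i ≡ false
  joins-irrefl i with p ≟ i | a ≟ i
  ... | yes refl | yes refl = ⊥-elim (p≢a refl)
  ... | yes _    | no _     = refl
  ... | no _     | yes _    = refl
  ... | no _     | no _     = refl

  H⁺ : Graph n
  H⁺ = record
    { adj    = λ i j → adj H i j ∨ joins i j
    ; sym    = λ i j → cong₂ _∨_ (adj-sym H i j)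
                 (trans (∨-comm (does (p ≟ i) ∧ does (a ≟ j)) _)
                   (cong₂ _∨_ (∧-comm (does (a ≟ i)) _) (∧-comm (does (p ≟ i)) _)))
    ; irrefl = λ i → cong₂ _∨_ (irrefl H i) (joins-irrefl i)
    }

  H⁺⁻¹ : ∀ {i j} → Adjacent H⁺ i j → Adjacent H i j ⊎ (p ≡ i × a ≡ j) ⊎ (a ≡ i × p ≡ j)
  H⁺⁻¹ {i} {j} t with Equivalence.to (T-∨ {adj H i j}) t
  ... | inj₁ old = inj₁ old
  ... | inj₂ new = inj₂ (joins⁻¹ new)

  H⊆H⁺ : Subgraph H H⁺
  H⊆H⁺ i j ij = Equivalence.from (T-∨ {adj H i j}) (inj₁ ij)

  pa : Adjacent H⁺ p a
  pa = Equivalence.from (T-∨ {adj H p a}) (inj₂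
    (Equivalence.from (T-∨ {does (p ≟ p) ∧ does (a ≟ a)}) (inj₁
      (Equivalence.from (T-∧ {does (p ≟ p)}) (does-T p , does-T a)))))

  ap : Adjacent H⁺ a p
  ap = subst T (adj-sym H⁺ p a) pa

  isolatedʳ : ∀ j → ¬ Adjacent H j a
  isolatedʳ j ja = isolated j (subst T (adj-sym H j a) ja)

  from-a : ∀ {j} → Adjacent H⁺ a j → p ≡ j
  from-a aj with H⁺⁻¹ aj
  ... | inj₁ old               = ⊥-elim (isolated _ old)
  ... | inj₂ (inj₁ (p≡a , _))  = ⊥-elim (p≢a p≡a)
  ... | inj₂ (inj₂ (_ , p≡j))  = p≡j

  to-a : ∀ {i} → Adjacent H⁺ i a → p ≡ i
  to-a {i} ia = from-a (subst T (adj-sym H⁺ i a) ia)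

  avoiding-a : ∀ {i j} → a ≢ i → a ≢ j → Adjacent H⁺ i j → Adjacent H i j
  avoiding-a a≢i a≢j ij with H⁺⁻¹ ij
  ... | inj₁ old              = old
  ... | inj₂ (inj₁ (_ , a≡j)) = ⊥-elim (a≢j a≡j)
  ... | inj₂ (inj₂ (a≡i , _)) = ⊥-elim (a≢i a≡i)

  path-avoiding-a : ∀ x vs {y} → a ∉ x ∷ vs → PathList H⁺ x vs y → PathList H x vs y
  path-avoiding-a x []       _  x≡y        = x≡y
  path-avoiding-a x (z ∷ zs) a∉ (xz , path) =
    avoiding-a (a∉ ∘ here) (a∉ ∘ there ∘ here) xz , path-avoiding-a z zs (a∉ ∘ there) path

  -- A path can enter a only from p, and there is nowhere else to go from there.
  path-through-a : ∀ x vs {y} → Unique (x ∷ vs) → PathList H⁺ x vs y → a ∈ vs → a ≡ y × p ∈ x ∷ vs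
  path-through-a x (z ∷ [])     _ (xz , refl) (here refl) = refl , here (to-a xz)
  path-through-a x (z ∷ w ∷ ws) ((_ ∷ x≢w ∷ _) ∷ _) (xz , zw , _) (here refl) =
    ⊥-elim (x≢w (trans (sym (to-a xz)) (from-a zw)))
  path-through-a x (z ∷ zs) (_ ∷ uniq) (_ , path) (there a∈) with path-through-a z zs uniq path a∈
  ... | a≡y , p∈ = a≡y , there p∈

  -- A cycle avoiding `a` lies in `H`. On a cycle through `a`, both neighbours of `a` equal `p`, a
  -- repetition; the cases are `a` first, second, or later in the list.
  acyclic⁺ : Acyclic H → Acyclic H⁺
  acyclic⁺ _       (_ , _ ∷ [] , _ , s≤s () , _)
  acyclic⁺ acyclic (x , z ∷ w ∷ ws , y , len , uniq@((_ ∷ x≢ws) ∷ z≢ws ∷ _) , path , yx)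
    with _∈?_ _≟_ a (x ∷ z ∷ w ∷ ws)
  ... | no a∉ = acyclic (x , z ∷ w ∷ ws , y , len , uniq , path-avoiding-a x (z ∷ w ∷ ws) a∉ path
        , avoiding-a (λ { refl → a∉ (there (path-end H⁺ z (w ∷ ws) path)) }) (a∉ ∘ here) yx)
  ... | yes (here refl) = All.lookup z≢ws (path-end H⁺ w ws (proj₂ path))
        (trans (sym (from-a (proj₁ path))) (to-a yx))
  acyclic⁺ acyclic (x , z ∷ w ∷ ws , y , len , ((x≢z ∷ x≢ws) ∷ uniq) , (xz , zw , path) , yx)
      | yes (there (here refl)) = All.lookup x≢ws (here refl) (trans (sym (to-a xz)) (from-a zw))
  acyclic⁺ acyclic (x , z ∷ w ∷ ws , y , len , (x≢ ∷ uniq) , (xz , path) , yx)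
      | yes (there (there a∈)) with path-through-a z (w ∷ ws) uniq path a∈
  ... | refl , p∈ = All.lookup x≢ p∈ (sym (from-a yx))

  -- The alternatives in the new adjacency exclude one another, since `a` is isolated in `H` and
  -- differs from `p`; hence their indicators add.
  degree⁺ : ∀ i → degree H⁺ i ≡ degree H i + (δ p i + δ a i)
  degree⁺ i = begin
    degree H⁺ i
      ≡⟨ degree-total H⁺ i ⟩
    total (λ j → ind (adj H i j ∨ joins i j))
      ≡⟨ sum-map-cong pointwise (allFin n) ⟩
    total (λ j → ind (adj H i j) + (δ p i * δ a j + δ a i * δ p j))
      ≡⟨ sum-map-+ (λ j → ind (adj H i j)) _ (allFin n) ⟩
    total (λ j → ind (adj H i j)) + total (λ j → δ p i * δ a j + δ a i * δ p j)
      ≡⟨ cong₂ _+_ (sym (degree-total H i)) (sum-map-+ (λ j → δ p i * δ a j) _ (allFin n)) ⟩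
    degree H i + (total (λ j → δ p i * δ a j) + total (λ j → δ a i * δ p j))
      ≡⟨ cong (degree H i +_) (cong₂ _+_ (scaled (δ p i) a) (scaled (δ a i) p)) ⟩
    degree H i + (δ p i + δ a i) ∎
    where
    open ≡-Reasoning
    scaled : ∀ c x → total (λ j → c * δ x j) ≡ c
    scaled c x = trans (sum-map-* c (δ x) (allFin n)) (trans (cong (c *_) (total-δ x)) (*-identityʳ c))
    old-or-new : ∀ {j} → ¬ (T (adj H i j) × T (joins i j))
    old-or-new (old , new) with joins⁻¹ new
    ... | inj₁ (refl , refl) = isolatedʳ _ old
    ... | inj₂ (refl , refl) = isolated _ old
    one-way : ∀ {j} → ¬ (T (does (p ≟ i) ∧ does (a ≟ j)) × T (does (a ≟ i) ∧ does (p ≟ j)))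
    one-way (s , t) = p≢a (trans (T-does (proj₁ (Equivalence.to T-∧ s)))
                                 (sym (T-does (proj₁ (Equivalence.to T-∧ t)))))
    pointwise : ∀ j → ind (adj H i j ∨ joins i j) ≡ ind (adj H i j) + (δ p i * δ a j + δ a i * δ p j)
    pointwise j = trans (ind-∨ (adj H i j) (joins i j) old-or-new) (cong (ind (adj H i j) +_)
      (trans (ind-∨ (does (p ≟ i) ∧ does (a ≟ j)) _ one-way)
        (cong₂ _+_ (ind-∧ (does (p ≟ i)) _) (ind-∧ (does (a ≟ i)) _))))

-- From a tree inside G to a spanning tree

-- c is the indicator function of the vertices reached so far, D their degrees.
record PartialTree {n} (G : Graph n) (c D : Fin n → ℕ) : Set where
  field
    H         : Graph n
    subgraph  : Subgraph H G
    connected : ∀ {i j} → 1 ≤ c i → 1 ≤ c j → Walk H i j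
    acyclic   : Acyclic H
    inside    : ∀ {i j} → Adjacent H i j → 1 ≤ c i
    degrees   : ∀ i → degree H i ≡ D i

module _ {n : ℕ} {G : Graph n} where

  coerce : ∀ {c c′ D D′} → (∀ i → c i ≡ c′ i) → (∀ i → D i ≡ D′ i) →
    PartialTree G c D → PartialTree G c′ D′
  coerce c≗ D≗ P = record
    { PartialTree P
    ; connected = λ ci cj → connected (subst (1 ≤_) (sym (c≗ _)) ci) (subst (1 ≤_) (sym (c≗ _)) cj)
    ; inside    = λ ij → subst (1 ≤_) (c≗ _) (inside ij)
    ; degrees   = λ i → trans (degrees i) (D≗ i)
    }
    where open PartialTree P

  singleton : ∀ p → PartialTree G (δ p) (λ _ → 0)
  singleton p = record
    { H         = empty
    ; subgraph  = λ _ _ ()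
    ; connected = walk
    ; acyclic   = λ { (_ , _ ∷ _ ∷ _ , _ , _ , _ , _ , ()) }
    ; inside    = λ ()
    ; degrees   = λ i → trans (degree-total empty i) (zeros (allFin n))
    }
    where
    empty : Graph n
    empty = record { adj = λ _ _ → false ; sym = λ _ _ → refl ; irrefl = λ _ → refl }
    walk : ∀ {i j} → 1 ≤ δ p i → 1 ≤ δ p j → Walk empty i j
    walk {i} {j} pi pj with p ≟ i | p ≟ j
    ... | yes refl | yes refl = here p
    zeros : ∀ (xs : List (Fin n)) → sum (map (λ _ → 0) xs) ≡ 0
    zeros []       = refl
    zeros (_ ∷ xs) = zeros xs

  add-leaf : ∀ {c D p a} → PartialTree G c D → 1 ≤ c p → c a ≡ 0 → Adjacent G p a →
    PartialTree G (λ i → c i + δ a i) (λ i → D i + (δ p i + δ a i))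
  add-leaf {c} {D} {p} {a} P 1≤cp ca≡0 Gpa = record
    { H         = H⁺
    ; subgraph  = subgraph⁺
    ; connected = connected⁺
    ; acyclic   = acyclic⁺ acyclic
    ; inside    = inside⁺
    ; degrees   = λ i → trans (degree⁺ i) (cong (_+ (δ p i + δ a i)) (degrees i))
    }
    where
    open PartialTree P
    ca≱1 : ¬ (1 ≤ c a)
    ca≱1 1≤ca = n≮0 (subst (1 ≤_) ca≡0 1≤ca)
    p≢a : p ≢ a
    p≢a refl = ca≱1 1≤cp
    isolated : ∀ j → ¬ Adjacent H a j
    isolated j aj = ca≱1 (inside aj)
    open AddLeaf H p a p≢a isolated
    subgraph⁺ : Subgraph H⁺ G
    subgraph⁺ i j ij with H⁺⁻¹ ij
    ... | inj₁ old                  = subgraph i j old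
    ... | inj₂ (inj₁ (refl , refl)) = Gpa
    ... | inj₂ (inj₂ (refl , refl)) = subst T (adj-sym G p a) Gpa
    1≤ca+δ : 1 ≤ c a + δ a a
    1≤ca+δ = subst (λ z → 1 ≤ c a + z) (sym (δ-refl a)) (m≤n+m 1 (c a))
    inside⁺ : ∀ {i j} → Adjacent H⁺ i j → 1 ≤ c i + δ a i
    inside⁺ ij with H⁺⁻¹ ij
    ... | inj₁ old                  = ≤-trans (inside old) (m≤m+n _ _)
    ... | inj₂ (inj₁ (refl , refl)) = ≤-trans 1≤cp (m≤m+n _ _)
    ... | inj₂ (inj₂ (refl , refl)) = 1≤ca+δ
    old-or-leaf : ∀ i → 1 ≤ c i + δ a i → 1 ≤ c i ⊎ a ≡ i
    old-or-leaf i 1≤ with a ≟ i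
    ... | yes a≡i = inj₂ a≡i
    ... | no _    = inj₁ (subst (1 ≤_) (+-identityʳ (c i)) 1≤)
    connected⁺ : ∀ {i j} → 1 ≤ c i + δ a i → 1 ≤ c j + δ a j → Walk H⁺ i j
    connected⁺ {i} {j} ci cj with old-or-leaf i ci | old-or-leaf j cj
    ... | inj₁ ci′  | inj₁ cj′  = walk-map H⊆H⁺ (connected ci′ cj′)
    ... | inj₁ ci′  | inj₂ refl = walk-snoc (walk-map H⊆H⁺ (connected ci′ 1≤cp)) pa
    ... | inj₂ refl | inj₁ cj′  = step ap (walk-map H⊆H⁺ (connected 1≤cp cj′))
    ... | inj₂ refl | inj₂ refl = here a

  -- Each node is attached as a leaf to its parent, which is already present, followed by its
  -- subtree and then its later siblings. The bound by 1 rules out repeated vertices, and `esum`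
  -- records the two degree increments of each edge.
  grow : ∀ {d : Fin n → ℕ} {c D} p {k} (F : Forest d k) → PartialTree G c D → 1 ≤ c p →
    (∀ i → c i + nsum (λ x → δ x i) F ≤ 1) → esum (bad G) p F ≡ 0 →
    PartialTree G (λ i → c i + nsum (λ x → δ x i) F)
                  (λ i → D i + esum (λ x y → δ x i + δ y i) p F)
  grow p ∅ P _ _ _ = coerce (λ i → sym (+-identityʳ _)) (λ i → sym (+-identityʳ _)) P
  grow {c = c} {D} p (node a _ C S) P 1≤cp fresh good =
    coerce (λ i → assoc (c i) (δ a i) (nsum (λ x → δ x i) C) _)
           (λ i → assoc (D i) (δ p i + δ a i) (esum (λ x y → δ x i + δ y i) a C) _)
      (grow p S
        (grow a C (add-leaf P 1≤cp ca≡0 (adjacent-bad G (m+n≡0⇒m≡0 _ good)))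
          (subst (λ z → 1 ≤ c a + z) (sym (δ-refl a)) (m≤n+m 1 (c a)))
          (λ i → ≤-trans (m≤m+n _ _) (≤-trans (≤-reflexive (assoc (c i) (δ a i) _ _)) (fresh i)))
          (m+n≡0⇒m≡0 _ rest-good))
        (≤-trans 1≤cp (≤-trans (m≤m+n (c p) _) (m≤m+n _ _)))
        (λ i → ≤-trans (≤-reflexive (assoc (c i) (δ a i) _ _)) (fresh i))
        (m+n≡0⇒n≡0 (esum (bad G) a C) rest-good))
    where
    assoc : ∀ w x y z → w + x + y + z ≡ w + (x + (y + z))
    assoc = solve-∀
    rest-good : esum (bad G) a C + esum (bad G) p S ≡ 0
    rest-good = m+n≡0⇒n≡0 (bad G p a) good
    -- The node `a` itself uses up the allowance of 1 at `a`, so `a` has not been reached before.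
    ca≡0 : c a ≡ 0
    ca≡0 = full (δ-refl a) (fresh a)
      where
      full : ∀ {m x r} → x ≡ 1 → m + (x + r) ≤ 1 → m ≡ 0
      full {zero}      _    _        = refl
      full {suc m} {r = r} refl (s≤s le) = ⊥-elim (n≮0 (≤-trans (m≤n+m (suc r) m) le))

spanning-tree : ∀ {n} {G : Graph n} {d : Fin n → ℕ} (t : Tree d) → Spans t →
  edges (bad G) t ≡ 0 → Σ (Graph n) λ T → SpanningTree T G × HasDegreeSequence T d
spanning-tree {n} {G} {d} (tree p {k} d-p F) spans good =
  H , (subgraph , (λ u v → connected (reached u) (reached v)) , acyclic) , degree-H
  where
  once : ∀ i → δ p i + nsum (λ x → δ x i) F ≡ 1
  once i = trans (spans (λ x → δ x i))
    (trans (sum-map-cong (λ x → δ-sym x i) (allFin n)) (total-δ i))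
  grown : PartialTree G (λ i → δ p i + nsum (λ x → δ x i) F) (λ i → esum (λ x y → δ x i + δ y i) p F)
  grown = grow p F (singleton p) (≤-reflexive (sym (δ-refl p))) (λ i → ≤-reflexive (once i)) good
  open PartialTree grown
  reached : ∀ i → 1 ≤ δ p i + nsum (λ x → δ x i) F
  reached i = ≤-reflexive (sym (once i))
  degree-H : ∀ i → degree H i ≡ d i
  degree-H i = begin
    degree H i                                   ≡⟨ degrees i ⟩
    -- Counting edge ends at `i` gives `d x` for each node `x` equal to `i`; since `k` is `d p`, the
    -- root fits the same pattern.
    esum (λ x y → δ x i + δ y i) p F             ≡⟨ esum-degree (λ x → δ x i) p F ⟩
    k * δ p i + nsum (λ x → d x * δ x i) F
      ≡⟨ cong (λ c → c * δ p i + nsum (λ x → d x * δ x i) F) d-p ⟨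
    d p * δ p i + nsum (λ x → d x * δ x i) F     ≡⟨ spans (λ x → d x * δ x i) ⟩
    total (λ x → d x * δ x i)                    ≡⟨ sum-map-cong flip (allFin n) ⟩
    total (λ x → δ i x * d x)                    ≡⟨ total-δ* i d ⟩
    d i                                          ∎
    where
    open ≡-Reasoning
    flip : ∀ x → d x * δ x i ≡ δ i x * d x
    flip x = trans (*-comm (d x) _) (cong (_* d x) (δ-sym x i))

theorem2 : (n : ℕ) → 4 ≤ n → (G : Graph n) →
    (∀ u v → u ≢ v → ¬ Adjacent G u v → 3 * n ≤ 2 * (degree G u + degree G v) + 1) →
    (d : Fin n → ℕ) → Arboreal n d → (∀ i → d i ≤ 3) →
    Σ (Graph n) λ T → SpanningTree T G × HasDegreeSequence T d
theorem2 n 4≤n G ore d (1≤d , Σd) d≤3 =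
  let t , spans = realise 1≤d (≤-trans (s≤s z≤n) 4≤n) Σd
      t′ , spans′ , good = perfect G ore Σd d≤3 (edges (bad G) t) t spans ≤-refl
  in spanning-tree {G = G} t′ spans′ good
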